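{- Let $P$ be a $d$-dimensional zero-one matrix with a corner $1$-entry. Then for all positive integers $s$ and $n$, $$f(sn,P,d)\ge \frac{s^{d-1}}{(d-1)!}\,f(n,P,d).$$
   Context: A $d$-dimensional $n_1\times\cdots\times n_d$ zero-one matrix is an array $A=(a_{i_1,\ldots,i_d})$, $1\le i_\ell\le n_\ell$, with entries in $\{0,1\}$. A submatrix is obtained by selecting, for each $\ell$, a set of values of the $\ell$-th coordinate (keeping the order). $A$ contains a $d$-dimensional zero-one matrix $B$ if some submatrix of $A$ can be transformed into $B$ by changing any number of ones to zeros; otherwise $A$ avoids $B$. $f(n,B,d)$ denotes the maximum number of ones in a $d$-dimensional $n\times\cdots\times n$ zero-one matrix that avoids $B$. A corner entry of a $k_1\times\cdots\times k_d$ matrix $P=(p_{i_1,\ldots,i_d})$ is an entry $p_{i_1,\ldots,i_d}$ with $i_\tau\in\{1,k_\tau\}$ for every $1\le\tau\le d$; a corner $1$-entry is a corner entry equal to $1$. -}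

module Defs where

open import Data.Bool using (Bool; true; false; T) renaming (_≤_ to _≤ᵇ_)
open import Data.Bool.Properties using (T?) renaming (_≤?_ to _≤ᵇ?_)
open import Data.Fin using (Fin; zero; suc; toℕ; _<_; _<?_)
open import Data.Fin.Properties using (all?)
open import Data.List using (List; []; _∷_; [_]; map; filter; length; allFin; cartesianProductWith)
open import Data.List.Extrema.Nat using (max; xs≤max; argmax-sel)
open import Data.List.Membership.Propositional using (find)
open import Data.List.Membership.Propositional.Properties using (∈-allFin; ∈-map⁺; ∈-map⁻; ∈-filter⁺; ∈-filter⁻)
open import Data.List.Relation.Unary.All as All using (All)
open import Data.List.Relation.Unary.Any as Any using (Any; here; there)
open import Data.List.Relation.Unary.Any.Properties using (map⁺; cartesianProductWith⁺)
open import Data.Nat using (ℕ; zero; suc) renaming (_≤_ to _≤ⁿ_)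
open import Data.Nat.Properties using (n≤0⇒n≡0)
open import Data.Product using (∃; _×_; _,_; proj₁; proj₂)
open import Data.Sum using (_⊎_; inj₁; inj₂)
open import Function using (_∘_; id)
open import Relation.Binary.Definitions using (Monotonic₁)
open import Relation.Binary.PropositionalEquality
  using (_≡_; refl; sym; trans; cong; subst)
open import Relation.Nullary using (Dec; ¬_; ¬?)
open import Relation.Nullary.Decidable using (map′; _×-dec_; _→-dec_)

private
  variable
    d : ℕ
    ns : Fin d → ℕ

-- Coordinates are numbered from 0, so the ℓ-th one ranges over
-- 0, …, ns ℓ − 1 instead of 1, …, n_ℓ.

Index : (Fin d → ℕ) → Set
Index ns = ∀ ℓ → Fin (ns ℓ)

-- Index tuples are functions, and pointwise equal functions need not be
-- propositionally equal.  The second field makes sure that an entry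
-- depends on nothing but the coordinates of its index.

record Matrix {d} (ns : Fin d → ℕ) : Set where
  field
    entry      : Index ns → Bool
    entry-cong : ∀ {i j} → (∀ ℓ → i ℓ ≡ j ℓ) → entry i ≡ entry j

open Matrix public

-- Selecting k of n values while keeping their order is the same as giving
-- a strictly increasing map Fin k → Fin n.

IsSelection : {ks ns : Fin d → ℕ} → (∀ ℓ → Fin (ks ℓ) → Fin (ns ℓ)) → Set
IsSelection σ = ∀ ℓ → Monotonic₁ _<_ _<_ (σ ℓ)

submatrix : {ks ns : Fin d → ℕ} → Matrix ns → (∀ ℓ → Fin (ks ℓ) → Fin (ns ℓ)) → Matrix ks
submatrix A σ = record
  { entry      = λ i → entry A (λ ℓ → σ ℓ (i ℓ))
  ; entry-cong = λ i≗j → entry-cong A (λ ℓ → cong (σ ℓ) (i≗j ℓ))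
  }

-- B ≤ᵐ A: B arises from A by changing ones to zeros (false ≤ᵇ true).

_≤ᵐ_ : Matrix ns → Matrix ns → Set
B ≤ᵐ A = ∀ i → entry B i ≤ᵇ entry A i

Contains : {ks ns : Fin d → ℕ} → Matrix ns → Matrix ks → Set
Contains A B = ∃ λ σ → IsSelection σ × B ≤ᵐ submatrix A σ

Avoids : {ks ns : Fin d → ℕ} → Matrix ns → Matrix ks → Set
Avoids A B = ¬ Contains A B

IsCorner : {ks : Fin d → ℕ} → Index ks → Set
IsCorner {ks = ks} i = ∀ ℓ → toℕ (i ℓ) ≡ 0 ⊎ suc (toℕ (i ℓ)) ≡ ks ℓ

HasCornerOne : {ks : Fin d → ℕ} → Matrix ks → Set
HasCornerOne P = ∃ λ i → IsCorner i × entry P i ≡ true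

infixr 5 _∷ᶠ_

_∷ᶠ_ : {A : Fin (suc d) → Set} → A zero → (∀ ℓ → A (suc ℓ)) → ∀ ℓ → A ℓ
(x ∷ᶠ g) zero    = x
(x ∷ᶠ g) (suc ℓ) = g ℓ

choices : {A : Fin d → Set} → (∀ ℓ → List (A ℓ)) → List (∀ ℓ → A ℓ)
choices {zero}  xs = [ (λ ()) ]
choices {suc d} xs = cartesianProductWith _∷ᶠ_ (xs zero) (choices (xs ∘ suc))

indices : (ns : Fin d → ℕ) → List (Index ns)
indices ns = choices (λ ℓ → allFin (ns ℓ))

selections : (ks ns : Fin d → ℕ) → List (∀ ℓ → Fin (ks ℓ) → Fin (ns ℓ))
selections ks ns = choices (λ ℓ → choices (λ _ → allFin (ns ℓ)))

scalar : {ns : Fin 0 → ℕ} → Bool → Matrix ns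
scalar b = record { entry = λ _ → b ; entry-cong = λ _ → refl }

stack : {ns : Fin (suc d) → ℕ} → (Fin (ns zero) → Matrix (ns ∘ suc)) → Matrix ns
stack As = record
  { entry      = λ i → entry (As (i zero)) (i ∘ suc)
  ; entry-cong = λ {i} {j} i≗j →
      trans (entry-cong (As (i zero)) (i≗j ∘ suc))
            (cong (λ x → entry (As x) (j ∘ suc)) (i≗j zero))
  }

-- Every matrix occurs here, but only up to pointwise equality of entries
-- (matrices-complete below).

matrices : (ns : Fin d → ℕ) → List (Matrix ns)
matrices {zero}  ns = map scalar (false ∷ true ∷ [])
matrices {suc d} ns = map stack (choices (λ _ → matrices (ns ∘ suc)))

choices-complete :
  {A : Fin d → Set} {xs : ∀ ℓ → List (A ℓ)} {R : ∀ ℓ → A ℓ → Set} →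
  (∀ ℓ → Any (R ℓ) (xs ℓ)) → Any (λ g → ∀ ℓ → R ℓ (g ℓ)) (choices xs)
choices-complete {zero}  _ = here λ ()
choices-complete {suc d} p =
  cartesianProductWith⁺ _∷ᶠ_ (λ { r rs zero → r ; r rs (suc ℓ) → rs ℓ })
    (p zero) (choices-complete (p ∘ suc))

indices-complete : (i : Index ns) → Any (λ j → ∀ ℓ → i ℓ ≡ j ℓ) (indices ns)
indices-complete i = choices-complete (λ ℓ → ∈-allFin (i ℓ))

selections-complete : {ks ns : Fin d → ℕ} (σ : ∀ ℓ → Fin (ks ℓ) → Fin (ns ℓ)) →
                      Any (λ τ → ∀ ℓ x → σ ℓ x ≡ τ ℓ x) (selections ks ns)
selections-complete σ =
  choices-complete (λ ℓ → choices-complete (λ x → ∈-allFin (σ ℓ x)))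

_≈ᵐ_ : Matrix ns → Matrix ns → Set
A ≈ᵐ B = ∀ i → entry A i ≡ entry B i

matrices-complete : (A : Matrix ns) → Any (A ≈ᵐ_) (matrices ns)
matrices-complete {zero} A = map⁺ {f = scalar} (go (entry A (λ ())) refl)
  where
  go : ∀ b → entry A (λ ()) ≡ b → Any (λ b → A ≈ᵐ scalar b) (false ∷ true ∷ [])
  go false eq = here         λ i → trans (entry-cong A (λ ())) eq
  go true  eq = there (here (λ i → trans (entry-cong A (λ ())) eq))
matrices-complete {suc d} {ns} A =
  map⁺ {f = stack} (Any.map (λ {Bs} → glue Bs) (choices-complete (matrices-complete ∘ slice)))
  where
  slice : Fin (ns zero) → Matrix (ns ∘ suc)
  slice x = record
    { entry      = λ i → entry A (x ∷ᶠ i)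
    ; entry-cong = λ i≗j → entry-cong A λ { zero → refl ; (suc ℓ) → i≗j ℓ }
    }
  glue : (Bs : Fin (ns zero) → Matrix (ns ∘ suc)) →
         (∀ x → slice x ≈ᵐ Bs x) → A ≈ᵐ stack Bs
  glue Bs eq i = trans (entry-cong A λ { zero → refl ; (suc ℓ) → refl })
                    (eq (i zero) (i ∘ suc))

_≤ᵐ?_ : (B A : Matrix ns) → Dec (B ≤ᵐ A)
_≤ᵐ?_ {ns = ns} B A = map′ to from (All.all? (λ i → entry B i ≤ᵇ? entry A i) (indices ns))
  where
  to : All (λ i → entry B i ≤ᵇ entry A i) (indices ns) → B ≤ᵐ A
  to h i with j , j∈ , i≗j ← find (indices-complete i)
    rewrite entry-cong A i≗j | entry-cong B i≗j = All.lookup h j∈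
  from : B ≤ᵐ A → All (λ i → entry B i ≤ᵇ entry A i) (indices ns)
  from h = All.universal h _

isSelection? : {ks ns : Fin d → ℕ} → 
               (σ : ∀ ℓ → Fin (ks ℓ) → Fin (ns ℓ)) →
               Dec (IsSelection {ks = ks} {ns = ns} σ)
isSelection? σ = map′ (λ h ℓ {x} {y} → h ℓ x y) (λ h ℓ x y → h ℓ)
  (all? λ ℓ → all? λ x → all? λ y → (x <? y) →-dec (σ ℓ x <? σ ℓ y))

contains? : {ks ns : Fin d → ℕ} → (A : Matrix ns) (B : Matrix ks) → Dec (Contains A B)
contains? {ks = ks} {ns = ns} A B = map′ to from
  (Any.any? (λ σ → isSelection? {ks = ks} {ns = ns} σ ×-dec (B ≤ᵐ? submatrix A σ))
            (selections ks ns))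
  where
  Q : (∀ ℓ → Fin (ks ℓ) → Fin (ns ℓ)) → Set
  Q σ = IsSelection {ks = ks} {ns = ns} σ × B ≤ᵐ submatrix A σ
  to : Any Q (selections ks ns) → Contains A B
  to = Any.satisfied
  from : Contains A B → Any Q (selections ks ns)
  from (σ , inc , le) = Any.map move (selections-complete {ks = ks} {ns = ns} σ)
    where
    move : ∀ {τ} → (∀ ℓ x → σ ℓ x ≡ τ ℓ x) → Q τ
    move {τ} eq
      = (λ ℓ {x} {y} x<y → subst (_< τ ℓ y) (eq ℓ x) (subst (σ ℓ x <_) (eq ℓ y) (inc ℓ x<y)))
      , (λ i → subst (entry B i ≤ᵇ_) (entry-cong A (λ ℓ → eq ℓ (i ℓ))) (le i))

avoids? : {ks ns : Fin d → ℕ} → (A : Matrix ns) (B : Matrix ks) → Dec (Avoids A B)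
avoids? A B = ¬? (contains? A B)

ones : Matrix ns → ℕ
ones {ns = ns} A = length (filter (λ i → T? (entry A i)) (indices ns))

cube : ℕ → Fin d → ℕ
cube n _ = n

-- f n P is the maximum number of ones in a d-dimensional n × ⋯ × n matrix
-- avoiding P.  The 0 is only a default for the case that no matrix avoids
-- P, which does not happen when P has a one, as then the zero matrix does.
-- (f-upper and f-attained below show that f is this maximum.)

f : ℕ → {ks : Fin d → ℕ} → Matrix ks → ℕ
f n P = max 0 (map ones (filter (λ A → avoids? A P) (matrices (cube n))))

ones-cong : {A B : Matrix ns} → A ≈ᵐ B → ones A ≡ ones B
ones-cong {ns = ns} {A} {B} eq = go (indices ns)
  where
  go : ∀ is → length (filter (λ i → T? (entry A i)) is) ≡ length (filter (λ i → T? (entry B i)) is)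
  go []       = refl
  go (i ∷ is) rewrite eq i with entry B i
  ... | true  = cong suc (go is)
  ... | false = go is

Avoids-cong : {ks ns : Fin d → ℕ} {A B : Matrix ns} {P : Matrix ks} → A ≈ᵐ B → Avoids A P → Avoids B P
Avoids-cong {P = P} eq av (σ , inc , le) =
  av (σ , inc , λ i → subst (entry P i ≤ᵇ_) (sym (eq _)) (le i))

f-upper : ∀ n {ks : Fin d → ℕ} (P : Matrix ks) (A : Matrix (cube n)) → Avoids A P → ones A ≤ⁿ f n P
f-upper n P A av with B , B∈ , A≈B ← find (matrices-complete A) =
  subst (_≤ⁿ f n P) (sym (ones-cong {A = A} {B} A≈B))
    (All.lookup (xs≤max 0 _)
      (∈-map⁺ ones (∈-filter⁺ (λ A → avoids? A P) B∈ (Avoids-cong {A = A} {B} {P} A≈B av))))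

f-attained : ∀ n {ks : Fin d → ℕ} (P : Matrix ks) → ∃ (λ (A : Matrix (cube n)) → Avoids A P) →
             ∃ λ (A : Matrix (cube n)) → Avoids A P × ones A ≡ f n P
f-attained n P (A₀ , av₀)
  with argmax-sel id 0 (map ones (filter (λ A → avoids? A P) (matrices (cube n))))
... | inj₁ f≡0 = A₀ , av₀ ,
      trans (n≤0⇒n≡0 (subst (ones A₀ ≤ⁿ_) f≡0 (f-upper n P A₀ av₀))) (sym f≡0)
... | inj₂ f∈ with A , A∈ , f≡ ← ∈-map⁻ ones f∈ =
      A , proj₂ (∈-filter⁻ (λ A → avoids? A P) {xs = matrices (cube n)} A∈) , sym f≡

{-# OPTIONS --safe #-}
module Submission where

-- Reflecting P, let its corner 1-entry be at the origin, and write s = r + 1.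
-- Take an optimal A avoiding P and the compositions b of r into d parts, which
-- form an antichain of at least s^(d−1) / (d−1)! elements, and put a copy of A
-- into block b for each b.  If all ones of a copy of P come from ones in blocks
-- above the block of its corner, then they lie in that same block, because two
-- comparable compositions coincide.
--
-- Slices of P without ones after its last one in some direction ℓ, say t ℓ of
-- them, need extra care: they may be selected outside the block.  So only the
-- entries of A followed by at least t ℓ values in every direction ℓ are placed
-- in blocks, of side n − t ℓ.  Each other one of A is placed among the last t ℓ
-- values of some direction ℓ, where no one of P can be found.  The copies of
-- this one stay distinct there, since b is determined by any d − 1 of its parts.

open import Defs
open import Data.Fin using (Fin)
open import Data.Integer using (+_)
open import Data.Nat using (ℕ; NonZero; pred; _^_; _!; _*_)
open import Data.Nat.Properties using (_!≢0)
open import Data.Rational using (_/_; _≥_) renaming (_*_ to _*ℚ_)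

open import Algebra.Definitions.RawMonoid Data.Nat.+-0-rawMonoid using (sum)
open import Data.Bool using (Bool; true; false; T; b≤b; f≤t) renaming (_≤_ to _≤ᵇ_)
open import Data.Bool.Properties using (T?; T-≡)
open import Data.Fin as Fin using (zero; suc; toℕ; fromℕ<; opposite)
open import Data.Fin.Properties as Fin using (toℕ<n; toℕ-fromℕ<; toℕ-injective)
import Data.Integer as ℤ
import Data.Integer.Properties as ℤ
open import Data.List using (List; []; _∷_; [_]; _++_; map; filter; length; cartesianProduct; removeAt)
open import Data.List.Extrema.Nat using (argmax; argmax-all; f[xs]≤f[argmax])
open import Data.List.Membership.Propositional using (_∈_; find)
open import Data.List.Membership.Propositional.Properties using (∈-filter⁺; ∈-cartesianProduct⁻)
open import Data.List.Properties using (length-map; length-++; length-removeAt′)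
open import Data.List.Relation.Unary.All as All using (All; []; _∷_)
import Data.List.Relation.Unary.All.Properties as All
open import Data.List.Relation.Unary.AllPairs as AllPairs using (AllPairs; []; _∷_)
import Data.List.Relation.Unary.AllPairs.Properties as AllPairs
open import Data.List.Relation.Unary.Any as Any using (Any; here; there; any?; index)
open import Data.List.Relation.Unary.Unique.Propositional.Properties using (allFin⁺)
open import Data.List.Relation.Unary.Unique.Setoid using (Unique)
import Data.List.Relation.Unary.Unique.Setoid.Properties as Unique
open import Data.Nat as ℕ using (zero; suc; _+_; _∸_; _⊓_; _≤_; _<_; _<?_; z≤n; s≤s; s≤s⁻¹)
open import Data.Nat.Properties hiding (_!≢0)
open import Data.Nat.Tactic.RingSolver using (solve-∀)
open import Data.Product using (∃; _×_; _,_; proj₁; proj₂)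
import Data.Rational as ℚ
import Data.Rational.Properties as ℚ
import Data.Rational.Unnormalised as ℚᵘ
import Data.Rational.Unnormalised.Properties as ℚᵘ
open import Data.Sum using (inj₁; inj₂)
open import Data.Vec.Functional using (Vector; head; tail) renaming (_∷_ to _∷ᵛ_)
open import Function using (_∘_; id; Equivalence; mk⇔)
open import Relation.Binary using (Setoid)
open import Relation.Binary.Definitions using (Monotonic₁)
open import Relation.Binary.PropositionalEquality using (_≡_; _≗_; refl; sym; trans; cong; cong₂; subst; subst₂; setoid)
open import Relation.Nullary using (Dec; yes; no; ¬_; contradiction)
open import Relation.Nullary.Decidable using (_×-dec_; does-⇔; isYes; isYes≗does; toWitness; fromWitness)

private
  variable
    d : ℕ
    ns : Fin d → ℕ

-- Counting by pigeonhole, and lists of ones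

removeAt-Any : ∀ {Y : Set} {P Q : Y → Set} {ys} (p : Any P ys) → (∀ {y} → P y → ¬ Q y) →
               Any Q ys → Any Q (removeAt ys (index p))
removeAt-Any (here p)  disj (here q)  = contradiction q (disj p)
removeAt-Any (here p)  disj (there q) = q
removeAt-Any (there p) disj (here q)  = here q
removeAt-Any (there p) disj (there q) = there (removeAt-Any p disj q)

-- The partner of the head is removed from `ys`. The other elements keep their partners, because
-- none of them shares a partner with the head. A relation takes the place of an injective function
-- since index tuples are compared only pointwise.
pigeonhole : ∀ {X Y : Set} {R : X → Y → Set} {xs ys} →
             AllPairs (λ x x′ → ∀ y → R x y → ¬ R x′ y) xs →
             All (λ x → Any (R x) ys) xs → length xs ≤ length ys
pigeonhole []             []       = z≤n
pigeonhole {ys = ys} (apart ∷ aparts) (p ∷ ps) =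
  subst (_ ≤_) (sym (length-removeAt′ ys (index p)))
    (s≤s (pigeonhole aparts
      (All.zipWith (λ (disj , q) → removeAt-Any p (disj _) q) (apart , ps))))

pointwise : (Fin d → Set) → Setoid _ _
pointwise A = record
  { Carrier       = ∀ ℓ → A ℓ
  ; _≈_           = λ g h → ∀ ℓ → g ℓ ≡ h ℓ
  ; isEquivalence = record
    { refl  = λ _ → refl
    ; sym   = λ eq ℓ → sym (eq ℓ)
    ; trans = λ eq eq′ ℓ → trans (eq ℓ) (eq′ ℓ)
    }
  }

choices-unique : {A : Fin d → Set} {xs : ∀ ℓ → List (A ℓ)} →
                 (∀ ℓ → Unique (setoid (A ℓ)) (xs ℓ)) → Unique (pointwise A) (choices xs)
choices-unique {zero}      _   = [] ∷ []
choices-unique {suc d} {A} xs! =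
  Unique.cartesianProductWith⁺ (setoid (A zero)) (pointwise (A ∘ suc)) (pointwise A)
    _∷ᶠ_ (λ eq → eq zero , eq ∘ suc) (xs! zero) (choices-unique (xs! ∘ suc))

-- `ones A` is by definition the length of this list, so that `pigeonhole` compares numbers of ones.
oneIndices : Matrix ns → List (Index ns)
oneIndices {ns = ns} A = filter (λ i → T? (entry A i)) (indices ns)

oneIndices-unique : (A : Matrix ns) → Unique (pointwise (Fin ∘ ns)) (oneIndices A)
oneIndices-unique {ns = ns} A =
  Unique.filter⁺ (pointwise (Fin ∘ ns)) (λ i → T? (entry A i)) (choices-unique (λ ℓ → allFin⁺ (ns ℓ)))

oneIndices-sound : (A : Matrix ns) → All (T ∘ entry A) (oneIndices A)
oneIndices-sound {ns = ns} A = All.all-filter (λ i → T? (entry A i)) (indices ns)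

oneIndices-complete : (A : Matrix ns) (i : Index ns) → T (entry A i) →
                      Any (λ j → ∀ ℓ → i ℓ ≡ j ℓ) (oneIndices A)
oneIndices-complete A i Ai with j , j∈ , i≗j ← find (indices-complete i) =
  Any.map (λ { refl → i≗j })
    (∈-filter⁺ (λ i → T? (entry A i)) j∈ (subst T (entry-cong A i≗j) Ai))

-- Compositions

sum-mono : {b c : Vector ℕ d} → (∀ ℓ → b ℓ ≤ c ℓ) → sum b ≤ sum c
sum-mono {zero}  b≤c = z≤n
sum-mono {suc d} b≤c = +-mono-≤ (b≤c zero) (sum-mono (b≤c ∘ suc))

sum-cong : {b c : Vector ℕ d} → b ≗ c → sum b ≡ sum c
sum-cong b≗c = ≤-antisym (sum-mono (≤-reflexive ∘ b≗c)) (sum-mono (≤-reflexive ∘ sym ∘ b≗c))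

-- A smaller head in `b` could not be made up for by its tail, which is bounded by the tail of `c`
-- as well.
sum-antichain : {b c : Vector ℕ d} → (∀ ℓ → b ℓ ≤ c ℓ) → sum b ≡ sum c → b ≗ c
sum-antichain {suc d} {b} {c} b≤c eq zero = ≤-antisym (b≤c zero)
  (+-cancelʳ-≤ (sum (tail c)) _ _
    (≤-trans (≤-reflexive (sym eq)) (+-monoʳ-≤ (b zero) (sum-mono (b≤c ∘ suc)))))
sum-antichain {suc d} {b} {c} b≤c eq (suc ℓ) = sum-antichain (b≤c ∘ suc)
  (+-cancelˡ-≡ (c zero) _ _
    (trans (cong (_+ sum (tail b)) (sym (sum-antichain {b = b} {c} b≤c eq zero))) eq)) ℓ

entry≤sum : (b : Vector ℕ d) → ∀ ℓ → b ℓ ≤ sum b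
entry≤sum b zero    = m≤m+n _ _
entry≤sum b (suc ℓ) = ≤-trans (entry≤sum (tail b) ℓ) (m≤n+m _ _)

incrementHead : Vector ℕ (suc d) → Vector ℕ (suc d)
incrementHead b = suc (head b) ∷ᵛ tail b

-- The recursion splits on whether the first part is zero. This is Pascal's rule, so there are
-- `m + e` choose `e` compositions of `m` into `suc e` parts.
compositions : (e m : ℕ) → List (Vector ℕ (suc e))
compositions zero    m       = [ (λ _ → m) ]
compositions (suc e) zero    = map (0 ∷ᵛ_) (compositions e zero)
compositions (suc e) (suc m) =
  map (0 ∷ᵛ_) (compositions e (suc m)) ++ map incrementHead (compositions (suc e) m)

compositions-sum : ∀ e m → All (λ b → sum b ≡ m) (compositions e m)
compositions-sum zero    m       = +-identityʳ m ∷ []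
compositions-sum (suc e) zero    = All.map⁺ (compositions-sum e zero)
compositions-sum (suc e) (suc m) = All.++⁺
  (All.map⁺ (compositions-sum e (suc m)))
  (All.map⁺ (All.map (cong suc) (compositions-sum (suc e) m)))

compositions-unique : ∀ e m → Unique (pointwise (λ _ → ℕ)) (compositions e m)
compositions-unique zero    m       = [] ∷ []
compositions-unique (suc e) zero    =
  Unique.map⁺ (pointwise _) (pointwise _) (λ eq → eq ∘ suc) (compositions-unique e zero)
compositions-unique (suc e) (suc m) = AllPairs.++⁺
  (Unique.map⁺ (pointwise _) (pointwise _) (λ eq → eq ∘ suc) (compositions-unique e (suc m)))
  (Unique.map⁺ (pointwise _) (pointwise _)
    (λ { eq zero → suc-injective (eq zero) ; eq (suc ℓ) → eq (suc ℓ) })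
    (compositions-unique (suc e) m))
  (All.map⁺ (All.universal (λ _ → All.map⁺ (All.universal (λ _ eq → 0≢1+n (eq zero)) _)) _))

-- The difference of the two powers factors into a sum of `suc e` products, each of them at most
-- `suc x ^ e`.
^-suc-step : ∀ e x → suc x ^ suc e ≤ x ^ suc e + suc e * suc x ^ e
^-suc-step zero    x = ≤-reflexive (lemma x)
  where
  lemma : ∀ x → suc x * 1 ≡ x * 1 + 1
  lemma = solve-∀
^-suc-step (suc e) x = begin
  suc x * suc x ^ suc e                                    ≤⟨ +-monoʳ-≤ Y (*-monoʳ-≤ x (^-suc-step e x)) ⟩
  Y + x * (x ^ suc e + suc e * suc x ^ e)                  ≤⟨ m≤m+n _ (suc e * suc x ^ e) ⟩
  Y + x * (x ^ suc e + suc e * suc x ^ e) + suc e * suc x ^ e ≡⟨ lemma x (suc e) (x ^ suc e) (suc x ^ e) ⟩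
  x * x ^ suc e + suc (suc e) * suc x ^ suc e              ∎
  where
  open ≤-Reasoning
  Y = suc x ^ suc e
  lemma : ∀ x E X Z → suc x * Z + x * (X + E * Z) + E * Z ≡ x * X + suc E * (suc x * Z)
  lemma = solve-∀

-- In closed form the right side is the product of `m + 1`, ..., `m + e`, whose factors are all at
-- least `suc m`. The induction follows Pascal's rule instead, and `^-suc-step` splits the power in
-- the same way.
compositions-length : ∀ e m → suc m ^ e ≤ e ! * length (compositions e m)
compositions-length zero    m    = ≤-refl
compositions-length (suc e) zero = begin
  1 * 1 ^ e                         ≡⟨ *-identityˡ (1 ^ e) ⟩
  1 ^ e                             ≤⟨ compositions-length e zero ⟩
  e ! * length C                    ≤⟨ *-monoˡ-≤ (length C) (m≤n*m (e !) (suc e)) ⟩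
  suc e ! * length C                ≡⟨ cong (suc e ! *_) (length-map (0 ∷ᵛ_) C) ⟨
  suc e ! * length (map (0 ∷ᵛ_) C)  ∎
  where
  open ≤-Reasoning
  C = compositions e zero
compositions-length (suc e) (suc m) = begin
  suc (suc m) ^ suc e                                    ≤⟨ ^-suc-step e (suc m) ⟩
  suc m ^ suc e + suc e * suc (suc m) ^ e
    ≤⟨ +-mono-≤ (compositions-length (suc e) m) (*-monoʳ-≤ (suc e) (compositions-length e (suc m))) ⟩
  suc e ! * length C′ + suc e * (e ! * length C)         ≡⟨ lemma (suc e) (e !) (length C) (length C′) ⟩
  suc e ! * (length C + length C′)
    ≡⟨ cong (suc e ! *_) (cong₂ _+_ (length-map (0 ∷ᵛ_) C) (length-map incrementHead C′)) ⟨
  suc e ! * (length (map (0 ∷ᵛ_) C) + length (map incrementHead C′))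
    ≡⟨ cong (suc e ! *_) (length-++ (map (0 ∷ᵛ_) C)) ⟨
  suc e ! * length (compositions (suc e) (suc m))        ∎
  where
  open ≤-Reasoning
  C  = compositions e (suc m)
  C′ = compositions (suc e) m
  lemma : ∀ E F L L′ → E * F * L′ + E * (F * L) ≡ E * F * (L + L′)
  lemma = solve-∀

-- Placement of the copies

quotient-≤ : ∀ {w b c x y} → b * w + x ≤ c * w + y → y < w → b ≤ c
quotient-≤ {w} {b} {c} {x} {y} le y<w = ≮⇒≥ λ c<b → <-irrefl refl (begin-strict
  b * w + x ≤⟨ le ⟩
  c * w + y <⟨ +-monoʳ-< (c * w) y<w ⟩
  c * w + w ≡⟨ +-comm (c * w) w ⟩
  suc c * w ≤⟨ *-monoˡ-≤ w c<b ⟩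
  b * w     ≤⟨ m≤m+n (b * w) x ⟩
  b * w + x ∎)
  where open ≤-Reasoning

divMod-unique : ∀ {w b c x y} → b * w + x ≡ c * w + y → x < w → y < w → b ≡ c × x ≡ y
divMod-unique {w} {b} {c} {x} {y} eq x<w y<w
  with refl ← ≤-antisym {b} {c} (quotient-≤ (≤-reflexive eq) y<w) (quotient-≤ (≤-reflexive (sym eq)) x<w)
  = refl , +-cancelˡ-≡ (b * w) x y eq

block-bound : ∀ {b w x c} → b < c → x < w → b * w + x < c * w
block-bound {b} {w} {x} {c} b<c x<w = begin-strict
  b * w + x <⟨ +-monoʳ-< (b * w) x<w ⟩
  b * w + w ≡⟨ +-comm (b * w) w ⟩
  suc b * w ≤⟨ *-monoˡ-≤ w b<c ⟩
  c * w     ∎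
  where open ≤-Reasoning

module _ (r n : ℕ) where

  -- A coordinate a ℓ of a copy is outer when it is one of the last t ℓ of its n
  -- values.  The first outer coordinate is put among the last t ℓ values of
  -- suc r * n, whatever b ℓ is.
  place : (t b a : Vector ℕ d) → Vector ℕ d
  place {zero}  t b a = λ ()
  place {suc d} t b a with a zero <? n ∸ t zero
  ... | yes _ = (b zero * (n ∸ t zero) + a zero) ∷ᵛ place (tail t) (tail b) (tail a)
  ... | no  _ = (r * n + a zero) ∷ᵛ λ ℓ → b (suc ℓ) * n + a (suc ℓ)

  place-< : (t b a : Vector ℕ d) → (∀ ℓ → b ℓ ≤ r) → (∀ ℓ → a ℓ < n) → ∀ ℓ → place t b a ℓ < suc r * n
  place-< {suc d} t b a b≤r a<n ℓ with a zero <? n ∸ t zero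
  place-< t b a b≤r a<n zero    | yes a<w =
    <-≤-trans (block-bound (s≤s (b≤r zero)) a<w) (*-monoʳ-≤ (suc r) (m∸n≤m n (t zero)))
  place-< t b a b≤r a<n (suc ℓ) | yes _   = place-< (tail t) (tail b) (tail a) (b≤r ∘ suc) (a<n ∘ suc) ℓ
  place-< t b a b≤r a<n zero    | no _    = block-bound {r} ≤-refl (a<n zero)
  place-< t b a b≤r a<n (suc ℓ) | no _    = block-bound (s≤s (b≤r (suc ℓ))) (a<n (suc ℓ))

  slab-disjoint : ∀ {t b a a′} → b ≤ r → a < n ∸ t → ¬ a′ < n ∸ t → b * (n ∸ t) + a < r * n + a′
  slab-disjoint {t} {b} {a} {a′} b≤r a<w a′≮w =
    +-mono-≤-< (*-mono-≤ b≤r (m∸n≤m n t)) (<-≤-trans a<w (≮⇒≥ a′≮w))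

  -- By `slab-disjoint`, both tuples have their first outer coordinate in the same direction. Before
  -- it, `b ℓ` and `a ℓ` are quotient and remainder modulo `n ∸ t ℓ`. After it they are so modulo
  -- `n`, the side of the blocks there, which leaves room for further outer coordinates.
  place-injective : (t b a b′ a′ : Vector ℕ d) → (∀ ℓ → b ℓ ≤ r) → (∀ ℓ → b′ ℓ ≤ r) →
                    (∀ ℓ → a ℓ < n) → (∀ ℓ → a′ ℓ < n) → sum b ≡ sum b′ →
                    place t b a ≗ place t b′ a′ → ∀ ℓ → b ℓ ≡ b′ ℓ × a ℓ ≡ a′ ℓ
  place-injective {suc d} t b a b′ a′ b≤r b′≤r a<n a′<n sums eq
    with a zero <? n ∸ t zero | a′ zero <? n ∸ t zero
  ... | yes p | no q = contradiction (eq zero) (<⇒≢ (slab-disjoint {t zero} (b≤r zero) p q))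
  ... | no p | yes q = contradiction (sym (eq zero)) (<⇒≢ (slab-disjoint {t zero} (b′≤r zero) q p))
  ... | yes p | yes q = λ
    { zero    → heads
    ; (suc ℓ) → place-injective (tail t) (tail b) (tail a) (tail b′) (tail a′)
        (b≤r ∘ suc) (b′≤r ∘ suc) (a<n ∘ suc) (a′<n ∘ suc)
        (+-cancelˡ-≡ (b′ zero) _ _ (trans (cong (_+ sum (tail b)) (sym (proj₁ heads))) sums))
        (eq ∘ suc) ℓ
    }
    where
    heads : b zero ≡ b′ zero × a zero ≡ a′ zero
    heads = divMod-unique (eq zero) p q
  -- The head of b is not recorded in this case but determined by the sum.
  ... | no _ | no _ = λ
    { zero    → +-cancelʳ-≡ (sum (tail b′)) _ _
                  (trans (cong (λ z → b zero + z) (sym (sum-cong (proj₁ ∘ tails)))) sums)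
              , +-cancelˡ-≡ (r * n) _ _ (eq zero)
    ; (suc ℓ) → tails ℓ
    }
    where
    tails : ∀ ℓ → b (suc ℓ) ≡ b′ (suc ℓ) × a (suc ℓ) ≡ a′ (suc ℓ)
    tails ℓ = divMod-unique (eq (suc ℓ)) (a<n (suc ℓ)) (a′<n (suc ℓ))

  -- The first outer coordinate would be placed at `r * n + (n ∸ t ℓ)` or later, leaving fewer than
  -- `t ℓ` values after it, against `bound`.
  place-inner : (t b a : Vector ℕ d) → (∀ ℓ → place t b a ℓ + t ℓ < suc r * n) →
                ∀ ℓ → a ℓ < n ∸ t ℓ × place t b a ℓ ≡ b ℓ * (n ∸ t ℓ) + a ℓ
  place-inner {suc d} t b a bound ℓ with a zero <? n ∸ t zero
  place-inner {suc d} t b a bound zero    | yes p = p , refl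
  place-inner {suc d} t b a bound (suc ℓ) | yes _ = place-inner (tail t) (tail b) (tail a) (bound ∘ suc) ℓ
  place-inner {suc d} t b a bound ℓ       | no p  = contradiction (bound zero) (≤⇒≯ (begin
    n + r * n                   ≡⟨ +-comm n (r * n) ⟩
    r * n + n                   ≤⟨ +-monoʳ-≤ (r * n) (≤-trans (m≤n+m∸n n (t zero)) (+-monoʳ-≤ (t zero) (≮⇒≥ p))) ⟩
    r * n + (t zero + a zero)   ≡⟨ cong (λ z → r * n + z) (+-comm (t zero) (a zero)) ⟩
    r * n + (a zero + t zero)   ≡⟨ +-assoc (r * n) _ _ ⟨
    r * n + a zero + t zero     ∎))
    where open ≤-Reasoning

-- Strictly increasing maps

-- Each step from `x` to `y` raises `g` by at least one. The inequality between the differences is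
-- written additively to avoid truncated subtraction.
gap : (g : Fin d → ℕ) → Monotonic₁ Fin._<_ _<_ g → ∀ x y → toℕ x ≤ toℕ y →
      toℕ y + g x ≤ toℕ x + g y
gap                 g g-mono zero    zero    _   = ≤-refl
gap {suc zero}      g g-mono zero    (suc ()) _
gap {suc (suc d)}   g g-mono zero    (suc y) _   = begin
  suc (toℕ y) + g zero          ≡⟨ +-suc (toℕ y) (g zero) ⟨
  toℕ y + suc (g zero)          ≤⟨ +-monoʳ-≤ (toℕ y) (g-mono {zero} {suc zero} (s≤s z≤n)) ⟩
  toℕ y + g (suc zero)          ≤⟨ gap (g ∘ suc) (λ x<y → g-mono (s≤s x<y)) zero y z≤n ⟩
  g (suc y)                     ∎
  where open ≤-Reasoning
gap                 g g-mono (suc x) (suc y) x≤y =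
  s≤s (gap (g ∘ suc) (λ x<y → g-mono (s≤s x<y)) x y (s≤s⁻¹ x≤y))

-- This is `gap` between `x` and the last index, whose value is below `m`: after `g x` there is room
-- for all later values.
gap-end : ∀ {k m} (g : Fin k → Fin m) → Monotonic₁ Fin._<_ Fin._<_ g → ∀ x → k + toℕ (g x) ≤ toℕ x + m
gap-end {suc k} {m} g g-mono x = begin
  suc k + toℕ (g x)               ≡⟨ cong (λ z → suc z + toℕ (g x)) (Fin.toℕ-fromℕ k) ⟨
  suc (toℕ last + toℕ (g x))      ≤⟨ s≤s (gap (toℕ ∘ g) g-mono x last
                                       (subst (toℕ x ≤_) (sym (Fin.toℕ-fromℕ k)) (Fin.toℕ≤pred[n] x))) ⟩
  suc (toℕ x + toℕ (g last))      ≡⟨ +-suc (toℕ x) _ ⟨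
  toℕ x + suc (toℕ (g last))      ≤⟨ +-monoʳ-≤ (toℕ x) (toℕ<n (g last)) ⟩
  toℕ x + m                       ∎
  where
  open ≤-Reasoning
  last = Fin.fromℕ k

-- A selection whose values at 0, …, j lie in the inner part [β , β + (n ∸ t))
-- of a block of side n is moved into [0 , n): the minimum agrees with the
-- shift by β up to j, and after j there is room since only t values remain.

straighten : ∀ {k m n t β} (g : Fin k → Fin m) → Monotonic₁ Fin._<_ Fin._<_ g →
             ∀ z j → toℕ z ≡ 0 → suc (toℕ j) + t ≡ k →
             β ≤ toℕ (g z) → toℕ (g j) < β + (n ∸ t) →
             ∃ λ (h : Fin k → Fin n) → Monotonic₁ Fin._<_ Fin._<_ h ×
               (∀ i → toℕ i ≤ toℕ j → toℕ (g i) ≡ β + toℕ (h i))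
straighten {k} {m} {n} {t} {β} g g-mono z j z≡0 j+t≡k β≤gz gj<β+w =
  h , h-mono , λ i i≤j → sym (trans
    (cong (λ y → β + y) (trans (toℕ-fromℕ< (value-< i)) (m≤n⇒m⊓n≡m (m+n≤o⇒m≤o∸n _ (room i i≤j)))))
    (m+[n∸m]≡n (β≤g i)))
  where
  open ≤-Reasoning

  z≤ : ∀ i → toℕ z ≤ toℕ i
  z≤ i = subst (_≤ toℕ i) (sym z≡0) z≤n

  β≤g : ∀ i → β ≤ toℕ (g i)
  β≤g i = ≤-trans β≤gz (m+n≤o⇒n≤o (toℕ i)
    (subst (λ y → toℕ i + toℕ (g z) ≤ y + toℕ (g i)) z≡0 (gap (toℕ ∘ g) g-mono z i (z≤ i))))

  -- The inner part of the block contains `g j`, so it is not empty.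
  t<n : t < n
  t<n = m∸n≢0⇒n<m λ w≡0 → <-irrefl refl (begin-strict
    β             ≤⟨ β≤g j ⟩
    toℕ (g j)     <⟨ gj<β+w ⟩
    β + (n ∸ t)   ≡⟨ cong (λ y → β + y) w≡0 ⟩
    β + 0         ≡⟨ +-identityʳ β ⟩
    β             ∎)

  -- From `i` to `j` the selection climbs by at least the difference of the indices, and `g j` has
  -- at least `t` values of the block after it. Hence up to `j` the first term of the minimum in
  -- `value` is the smaller one.
  room : ∀ i → toℕ i ≤ toℕ j → toℕ (g i) ∸ β + k ≤ n + toℕ i
  room i i≤j = +-cancelˡ-≤ β _ _ (begin
    β + (toℕ (g i) ∸ β + k)              ≡⟨ +-assoc β _ k ⟨
    β + (toℕ (g i) ∸ β) + k              ≡⟨ cong₂ _+_ (m+[n∸m]≡n (β≤g i)) (sym j+t≡k) ⟩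
    toℕ (g i) + (suc (toℕ j) + t)        ≡⟨ lemma₁ (toℕ (g i)) (toℕ j) t ⟩
    suc (toℕ j + toℕ (g i)) + t          ≤⟨ +-monoˡ-≤ t (s≤s (gap (toℕ ∘ g) g-mono i j i≤j)) ⟩
    suc (toℕ i + toℕ (g j)) + t          ≡⟨ cong (_+ t) (sym (+-suc (toℕ i) _)) ⟩
    toℕ i + suc (toℕ (g j)) + t          ≤⟨ +-monoˡ-≤ t (+-monoʳ-≤ (toℕ i) gj<β+w) ⟩
    toℕ i + (β + (n ∸ t)) + t            ≡⟨ lemma₂ (toℕ i) β (n ∸ t) t ⟩
    β + (n ∸ t + t + toℕ i)              ≡⟨ cong (λ y → β + (y + toℕ i)) (m∸n+n≡m (<⇒≤ t<n)) ⟩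
    β + (n + toℕ i)                      ∎)
    where
    lemma₁ : ∀ a b c → a + (suc b + c) ≡ suc (b + a) + c
    lemma₁ = solve-∀
    lemma₂ : ∀ a b c d → a + (b + c) + d ≡ b + (c + d + a)
    lemma₂ = solve-∀

  value : Fin k → ℕ
  value x = (toℕ (g x) ∸ β) ⊓ (n + toℕ x ∸ k)

  value-< : ∀ x → value x < n
  value-< x = ≤-<-trans (m⊓n≤n (toℕ (g x) ∸ β) _)
    (m<n+o⇒m∸n<o (n + toℕ x) k {{ℕ.>-nonZero (≤-<-trans z≤n t<n)}}
      (subst (n + toℕ x <_) (+-comm n k) (+-monoʳ-< n (toℕ<n x))))

  -- With this the subtraction of `k` in `value` is never truncated, so the second term of the
  -- minimum increases strictly too.
  k≤n+ : ∀ x → k ≤ n + toℕ x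
  k≤n+ x = ≤-trans (m+n≤o⇒n≤o (toℕ (g z) ∸ β) (room z (z≤ j))) (+-monoʳ-≤ n (z≤ x))

  h : Fin k → Fin n
  h x = fromℕ< (value-< x)

  h-mono : Monotonic₁ Fin._<_ Fin._<_ h
  h-mono {x} {y} x<y
    rewrite toℕ-fromℕ< (value-< x) | toℕ-fromℕ< (value-< y) =
    ⊓-mono-< (∸-monoˡ-< (g-mono x<y) (β≤g x)) (∸-monoˡ-< (+-monoʳ-< n x<y) (k≤n+ x))

-- The blown-up matrix

length-cartesianProduct : ∀ {X Y : Set} (xs : List X) (ys : List Y) →
                          length (cartesianProduct xs ys) ≡ length xs * length ys
length-cartesianProduct []       ys = refl
length-cartesianProduct (x ∷ xs) ys =
  trans (length-++ (map (x ,_) ys)) (cong₂ _+_ (length-map (x ,_) ys) (length-cartesianProduct xs ys))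

T⇒≤ᵇ : ∀ {p q} → (T p → T q) → p ≤ᵇ q
T⇒≤ᵇ {false} {false} _   = b≤b
T⇒≤ᵇ {false} {true}  _   = f≤t
T⇒≤ᵇ {true}  {true}  _   = b≤b
T⇒≤ᵇ {true}  {false} imp = contradiction (imp _) id

≤ᵇ⇒T : ∀ {p q} → p ≤ᵇ q → T p → T q
≤ᵇ⇒T b≤b p = p

module Blowup {e n} (r : ℕ) (t : Vector ℕ (suc e)) (A : Matrix (cube {suc e} n)) where

  -- The sum and the one of `A` are recorded here so that they can be recovered from a one of
  -- `blowup` without returning to membership in `pairs`.
  Lands : Vector ℕ (suc e) × Index (cube {suc e} n) → Index (cube {suc e} (suc r * n)) → Set
  Lands (b , a) x = sum b ≡ r × T (entry A a) × (∀ ℓ → toℕ (x ℓ) ≡ place r n t b (toℕ ∘ a) ℓ)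

  lands? : ∀ p x → Dec (Lands p x)
  lands? (b , a) x = (sum b ≟ r) ×-dec T? (entry A a) ×-dec
                     Fin.all? (λ ℓ → toℕ (x ℓ) ≟ place r n t b (toℕ ∘ a) ℓ)

  Lands-resp : ∀ {p x y} → (∀ ℓ → x ℓ ≡ y ℓ) → Lands p x → Lands p y
  Lands-resp x≗y (s , Aa , eq) = s , Aa , λ ℓ → trans (cong toℕ (sym (x≗y ℓ))) (eq ℓ)

  pairs : List (Vector ℕ (suc e) × Index (cube {suc e} n))
  pairs = cartesianProduct (compositions e r) (oneIndices A)

  landed? : ∀ x → Dec (Any (λ p → Lands p x) pairs)
  landed? x = any? (λ p → lands? p x) pairs

  blowup : Matrix (cube {suc e} (suc r * n))
  blowup = record
    { entry      = λ x → isYes (landed? x)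
    ; entry-cong = λ {x} {y} x≗y →
        trans (isYes≗does (landed? x))
          (trans (does-⇔ (mk⇔ (Any.map (Lands-resp x≗y)) (Any.map (Lands-resp (sym ∘ x≗y))))
                          (landed? x) (landed? y))
                 (sym (isYes≗does (landed? y))))
    }

  Lands-injective : ∀ {b a b′ a′ x} → Lands (b , a) x → Lands (b′ , a′) x →
                    (∀ ℓ → b ℓ ≡ b′ ℓ) × (∀ ℓ → a ℓ ≡ a′ ℓ)
  Lands-injective {b} {a} {b′} {a′} (s , _ , eq) (s′ , _ , eq′) =
    (proj₁ ∘ both) , (toℕ-injective ∘ proj₂ ∘ both)
    where
    both : ∀ ℓ → b ℓ ≡ b′ ℓ × toℕ (a ℓ) ≡ toℕ (a′ ℓ)
    both = place-injective r n t b (toℕ ∘ a) b′ (toℕ ∘ a′)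
      (λ ℓ → subst (b ℓ ≤_) s (entry≤sum b ℓ)) (λ ℓ → subst (b′ ℓ ≤_) s′ (entry≤sum b′ ℓ))
      (toℕ<n ∘ a) (toℕ<n ∘ a′) (trans s (sym s′))
      (λ ℓ → trans (sym (eq ℓ)) (eq′ ℓ))

  lands-exists : ∀ {b a} → sum b ≡ r → T (entry A a) → ∃ (Lands (b , a))
  lands-exists {b} {a} s Aa = (λ ℓ → fromℕ< (bound ℓ)) , s , Aa , (λ ℓ → toℕ-fromℕ< (bound ℓ))
    where
    bound : ∀ ℓ → place r n t b (toℕ ∘ a) ℓ < suc r * n
    bound = place-< r n t b (toℕ ∘ a) (λ ℓ → subst (b ℓ ≤_) s (entry≤sum b ℓ)) (toℕ<n ∘ a)

  -- The pigeonhole principle applies to the pairs: each of them lands on a one, and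
  -- `Lands-injective` separates them.
  ones-blowup : length (compositions e r) * ones A ≤ ones blowup
  ones-blowup = subst (_≤ ones blowup) (length-cartesianProduct (compositions e r) (oneIndices A))
    (pigeonhole {R = Lands}
      (AllPairs.map (λ p≉q _ Lp Lq → p≉q (Lands-injective Lp Lq))
        (Unique.cartesianProduct⁺ (pointwise (λ _ → ℕ)) (pointwise (λ _ → Fin n))
          (compositions-unique e r) (oneIndices-unique A)))
      (All.tabulate landing))
    where
    landing : ∀ {p} → p ∈ pairs → Any (Lands p) (oneIndices blowup)
    landing {b , a} p∈ with b∈ , a∈ ← ∈-cartesianProduct⁻ (compositions e r) (oneIndices A) p∈
      with x , L ← lands-exists {b} {a} (All.lookup (compositions-sum e r) b∈)
                                        (All.lookup (oneIndices-sound A) a∈) =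
      Any.map (λ x≗y → Lands-resp x≗y L)
        (oneIndices-complete blowup x (fromWitness {a? = landed? x} (Any.map (λ { refl → L }) p∈)))

  module _ {ks : Fin (suc e) → ℕ} (P : Matrix ks)
           {o : Index ks} (o≡0 : ∀ ℓ → toℕ (o ℓ) ≡ 0) (Po : T (entry P o))
           (tops : Fin (suc e) → Index ks) (P-tops : ∀ ℓ → T (entry P (tops ℓ)))
           (tops-max : ∀ ℓ i → T (entry P i) → toℕ (i ℓ) ≤ toℕ (tops ℓ ℓ))
           (tops+t : ∀ ℓ → suc (toℕ (tops ℓ ℓ)) + t ℓ ≡ ks ℓ) where

    contains-from-blowup : Contains blowup P → Contains A P
    contains-from-blowup (σ , σ-mono , P≤) = contained
      where
      open ≤-Reasoning

      Decoded : Index ks → Set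
      Decoded i = ∃ λ b → ∃ λ a → sum b ≡ r × T (entry A a) ×
        (∀ ℓ → toℕ (a ℓ) < n ∸ t ℓ × toℕ (σ ℓ (i ℓ)) ≡ b ℓ * (n ∸ t ℓ) + toℕ (a ℓ))

      -- No one of `P` lies beyond `tops ℓ`, so in direction `ℓ` at least `t ℓ` selected values
      -- follow it. It is therefore not among the last `t ℓ` values, and `place-inner` applies.
      decode : ∀ i → T (entry P i) → Decoded i
      decode i Pi with (b , a) , s , Aa , eq ← Any.satisfied (toWitness {a? = landed? _} (≤ᵇ⇒T (P≤ i) Pi)) =
        b , a , s , Aa , λ ℓ → let a<w , place≡ = inner ℓ in a<w , trans (eq ℓ) place≡
        where
        bound : ∀ ℓ → place r n t b (toℕ ∘ a) ℓ + t ℓ < suc r * n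
        bound ℓ = subst (λ y → y + t ℓ < suc r * n) (eq ℓ) (+-cancelˡ-≤ (toℕ (i ℓ)) _ _ (begin
          toℕ (i ℓ) + suc (toℕ (σ ℓ (i ℓ)) + t ℓ)     ≡⟨ lemma (toℕ (i ℓ)) (toℕ (σ ℓ (i ℓ))) (t ℓ) ⟩
          suc (toℕ (i ℓ)) + t ℓ + toℕ (σ ℓ (i ℓ))
            ≤⟨ +-monoˡ-≤ _ (+-monoˡ-≤ (t ℓ) (s≤s (tops-max ℓ i Pi))) ⟩
          suc (toℕ (tops ℓ ℓ)) + t ℓ + toℕ (σ ℓ (i ℓ)) ≡⟨ cong (_+ toℕ (σ ℓ (i ℓ))) (tops+t ℓ) ⟩
          ks ℓ + toℕ (σ ℓ (i ℓ))                       ≤⟨ gap-end (σ ℓ) (σ-mono ℓ) (i ℓ) ⟩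
          toℕ (i ℓ) + suc r * n                        ∎))
          where
          lemma : ∀ x y z → x + suc (y + z) ≡ suc x + z + y
          lemma = solve-∀
        inner : ∀ ℓ → toℕ (a ℓ) < n ∸ t ℓ × place r n t b (toℕ ∘ a) ℓ ≡ b ℓ * (n ∸ t ℓ) + toℕ (a ℓ)
        inner = place-inner r n t b (toℕ ∘ a) bound

      σo≤ : ∀ (i : Index ks) ℓ → toℕ (σ ℓ (o ℓ)) ≤ toℕ (σ ℓ (i ℓ))
      σo≤ i ℓ = m+n≤o⇒n≤o (toℕ (i ℓ))
        (subst (λ y → toℕ (i ℓ) + toℕ (σ ℓ (o ℓ)) ≤ y + toℕ (σ ℓ (i ℓ))) (o≡0 ℓ)
          (gap (toℕ ∘ σ ℓ) (σ-mono ℓ) (o ℓ) (i ℓ) (subst (_≤ toℕ (i ℓ)) (sym (o≡0 ℓ)) z≤n)))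

      InBlock : Vector ℕ (suc e) → Set
      InBlock b = ∀ i → T (entry P i) → ∃ λ a → T (entry A a) ×
        (∀ ℓ → toℕ (a ℓ) < n ∸ t ℓ × toℕ (σ ℓ (i ℓ)) ≡ b ℓ * (n ∸ t ℓ) + toℕ (a ℓ))

      -- The origin is selected first in every direction, so its block `b₀` is at most the block `b`
      -- of any other one. Both have sum `r`, hence they agree.
      inBlock : ∃ InBlock
      inBlock with b₀ , _ , s₀ , _ , eq₀ ← decode o Po = b₀ , locate
        where
        locate : InBlock b₀
        locate i Pi with b , a , s , Aa , eq ← decode i Pi =
          a , Aa , λ ℓ → proj₁ (eq ℓ) ,
            trans (proj₂ (eq ℓ)) (cong (λ y → y * (n ∸ t ℓ) + toℕ (a ℓ)) (sym (b₀≗b ℓ)))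
          where
          b₀≗b : b₀ ≗ b
          b₀≗b = sum-antichain
            (λ ℓ → quotient-≤ (subst₂ _≤_ (proj₂ (eq₀ ℓ)) (proj₂ (eq ℓ)) (σo≤ i ℓ)) (proj₁ (eq ℓ)))
            (trans s₀ (sym s))

      Straightened : Vector ℕ (suc e) → Set
      Straightened b = ∀ ℓ → ∃ λ (h : Fin (ks ℓ) → Fin n) → Monotonic₁ Fin._<_ Fin._<_ h ×
        (∀ i → toℕ i ≤ toℕ (tops ℓ ℓ) → toℕ (σ ℓ i) ≡ b ℓ * (n ∸ t ℓ) + toℕ (h i))

      -- The two ends required by `straighten` come from two ones of `P`: the corner bounds the
      -- selection from below, and `tops ℓ` bounds it from above.
      straightened : ∀ {b} → InBlock b → Straightened b
      straightened {b} locate ℓ with locate o Po | locate (tops ℓ) (P-tops ℓ)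
      ... | _ , _ , eq₀ | _ , _ , eq = straighten (σ ℓ) (σ-mono ℓ) (o ℓ) (tops ℓ ℓ) (o≡0 ℓ) (tops+t ℓ)
        (subst (base ≤_) (sym (proj₂ (eq₀ ℓ))) (m≤m+n _ _))
        (subst (_< base + (n ∸ t ℓ)) (sym (proj₂ (eq ℓ))) (+-monoʳ-< base (proj₁ (eq ℓ))))
        where
        base : ℕ
        base = b ℓ * (n ∸ t ℓ)

      contains : ∀ {b} → InBlock b → Straightened b → Contains A P
      contains {b} locate st = (proj₁ ∘ st) , (proj₁ ∘ proj₂ ∘ st) , λ i → T⇒≤ᵇ (P⇒A i)
        where
        P⇒A : ∀ i → T (entry P i) → T (entry A (λ ℓ → proj₁ (st ℓ) (i ℓ)))
        -- A one of `P` is at most `tops ℓ` in each direction, where `straighten` preserves the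
        -- offset in the block. Its straightened position is thus the index `a` found in `A`.
        P⇒A i Pi with a , Aa , eq ← locate i Pi = subst T (entry-cong A λ ℓ →
          toℕ-injective (+-cancelˡ-≡ (b ℓ * (n ∸ t ℓ)) _ _
            (trans (sym (proj₂ (eq ℓ))) (proj₂ (proj₂ (st ℓ)) (i ℓ) (tops-max ℓ i Pi))))) Aa

      contained : Contains A P
      contained = let b , locate = inBlock in contains {b} locate (straightened {b} locate)

-- Comparison of extremal numbers

zeroMatrix : Matrix ns
zeroMatrix = record { entry = λ _ → false ; entry-cong = λ _ → refl }

-- An optimal `A` is turned into a competitor for `Q`. The factors `c` and `k` carry the numerator
-- and the denominator of a ratio without division.
f-compare : {ks ls : Fin d → ℕ} {P : Matrix ks} {Q : Matrix ls} {i : Index ks} (m n : ℕ) {c k : ℕ} →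
            T (entry P i) →
            (∀ (A : Matrix (cube m)) → Avoids A P →
              ∃ λ (B : Matrix (cube n)) → Avoids B Q × c * ones A ≤ k * ones B) →
            c * f m P ≤ k * f n Q
f-compare {P = P} {Q} {i} m n {c} {k} Pi construct
  -- As `P` has a one, the zero matrix avoids it, and so the maximum is attained.
  with A , A-avoids , ones≡f ← f-attained m P (zeroMatrix , λ (_ , _ , P≤) → ≤ᵇ⇒T (P≤ i) Pi)
  with B , B-avoids , ineq ← construct A A-avoids =
  ≤-trans (subst (λ y → c * y ≤ k * ones B) ones≡f ineq) (*-monoʳ-≤ k (f-upper n Q B B-avoids))

blowup-bound-origin : ∀ {e} {ks : Fin (suc e) → ℕ} (P : Matrix ks) {o} →
                      (∀ ℓ → toℕ (o ℓ) ≡ 0) → T (entry P o) →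
                      ∀ r n → suc r ^ e * f n P ≤ e ! * f (suc r * n) P
blowup-bound-origin {e} {ks} P {o} o≡0 Po r n =
  f-compare {P = P} {P} n (suc r * n) {suc r ^ e} {e !} Po λ A A-avoids →
  let open Blowup r t A in
  blowup , A-avoids ∘ contains-from-blowup P o≡0 Po top P-top top-max top+t , (begin
    suc r ^ e * ones A                             ≤⟨ *-monoˡ-≤ (ones A) (compositions-length e r) ⟩
    e ! * length (compositions e r) * ones A       ≡⟨ *-assoc (e !) _ _ ⟩
    e ! * (length (compositions e r) * ones A)     ≤⟨ *-monoʳ-≤ (e !) ones-blowup ⟩
    e ! * ones blowup                              ∎)
  where
  open ≤-Reasoning

  top : Fin (suc e) → Index ks
  -- The default value `o` is itself a one of `P`, so `top ℓ` is a one in any case.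
  top ℓ = argmax (λ i → toℕ (i ℓ)) o (oneIndices P)

  P-top : ∀ ℓ → T (entry P (top ℓ))
  P-top ℓ = argmax-all (λ i → toℕ (i ℓ)) Po (oneIndices-sound P)

  top-max : ∀ ℓ i → T (entry P i) → toℕ (i ℓ) ≤ toℕ (top ℓ ℓ)
  top-max ℓ i Pi with j , j∈ , i≗j ← find (oneIndices-complete P i Pi) =
    subst (λ y → toℕ y ≤ toℕ (top ℓ ℓ)) (sym (i≗j ℓ)) (All.lookup (f[xs]≤f[argmax] o (oneIndices P)) j∈)

  t : Vector ℕ (suc e)
  t ℓ = ks ℓ ∸ suc (toℕ (top ℓ ℓ))

  top+t : ∀ ℓ → suc (toℕ (top ℓ ℓ)) + t ℓ ≡ ks ℓ
  top+t ℓ = m+[n∸m]≡n (toℕ<n (top ℓ ℓ))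

-- Reflections

flip : ∀ {n} → Bool → Fin n → Fin n
flip true  = opposite
flip false = id

flip-involutive : ∀ {n} c (x : Fin n) → flip c (flip c x) ≡ x
flip-involutive true  = Fin.opposite-involutive
flip-involutive false _ = refl

opposite-anti : ∀ {n} {x y : Fin n} → x Fin.< y → opposite y Fin.< opposite x
opposite-anti {n} {x} {y} x<y rewrite Fin.opposite-prop x | Fin.opposite-prop y =
  ∸-monoʳ-< (s≤s x<y) (toℕ<n y)

flip-conjugate-mono : ∀ {k n} c {g : Fin k → Fin n} → Monotonic₁ Fin._<_ Fin._<_ g →
                      Monotonic₁ Fin._<_ Fin._<_ (flip c ∘ g ∘ flip c)
flip-conjugate-mono true  g-mono = opposite-anti ∘ g-mono ∘ opposite-anti
flip-conjugate-mono false g-mono = g-mono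

reflect : {ns : Fin d → ℕ} → (Fin d → Bool) → Matrix ns → Matrix ns
reflect c A = submatrix A (flip ∘ c)

-- Reversing both the arguments and the values of a strictly increasing map leaves it strictly
-- increasing. Conjugation by `flip` thus turns a copy of `Q` in the reflected matrix into a copy of
-- `P` in `A`.
reflect-avoids : {ks ns : Fin d → ℕ} (c : Fin d → Bool) {A : Matrix ns} {P Q : Matrix ks} → P ≈ᵐ reflect c Q →
                 Avoids A P → Avoids (reflect c A) Q
reflect-avoids c {A} P≈ A-avoids (σ , σ-mono , Q≤) = A-avoids
  ( (λ ℓ → flip (c ℓ) ∘ σ ℓ ∘ flip (c ℓ))
  , (λ ℓ → flip-conjugate-mono (c ℓ) (σ-mono ℓ))
  , (λ i → subst (_≤ᵇ _) (sym (P≈ i)) (Q≤ _)))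

ones-reflect : {ns : Fin d → ℕ} (c : Fin d → Bool) (A : Matrix ns) → ones A ≤ ones (reflect c A)
ones-reflect {ns = ns} c A = pigeonhole {R = λ i j → ∀ ℓ → i ℓ ≡ flip (c ℓ) (j ℓ)}
  (AllPairs.map (λ i≉i′ _ i≡ i′≡ → i≉i′ λ ℓ → trans (i≡ ℓ) (sym (i′≡ ℓ))) (oneIndices-unique A))
  (All.map (λ {i} Ai → Any.map (λ eq ℓ → trans (sym (flip-involutive (c ℓ) (i ℓ))) (cong (flip (c ℓ)) (eq ℓ)))
    (oneIndices-complete (reflect c A) (λ ℓ → flip (c ℓ) (i ℓ))
      (subst T (sym (entry-cong A (λ ℓ → flip-involutive (c ℓ) (i ℓ)))) Ai)))
    (oneIndices-sound A))

-- An inequality suffices: reflecting twice is the identity, so it can be applied in both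
-- directions.
f-reflect : {ks : Fin d → ℕ} (n : ℕ) (c : Fin d → Bool) {P Q : Matrix ks} {i : Index ks} →
            T (entry P i) → P ≈ᵐ reflect c Q → f n P ≤ f n Q
f-reflect n c {P} {Q} Pi P≈ = subst₂ _≤_ (*-identityˡ (f n P)) (*-identityˡ (f n Q))
  (f-compare {P = P} {Q} n n {1} {1} Pi λ A A-avoids →
    reflect c A , reflect-avoids c {A} {P} {Q} P≈ A-avoids , *-monoʳ-≤ 1 (ones-reflect c A))

-- The flipped directions are those in which the corner is given as the last value.
corner-reflection : {ks : Fin d → ℕ} {P : Matrix ks} → HasCornerOne P →
                    ∃ λ c → ∃ λ o → (∀ ℓ → toℕ (o ℓ) ≡ 0) × T (entry (reflect c P) o)
corner-reflection {ks = ks} {P} (i , i-corner , Pi) =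
  c , o , o≡0 , Equivalence.from T-≡ (trans (entry-cong P (λ ℓ → flip-involutive (c ℓ) (i ℓ))) Pi)
  where
  c : Fin _ → Bool
  c ℓ with i-corner ℓ
  ... | inj₁ _ = false
  ... | inj₂ _ = true

  o : Index ks
  o ℓ = flip (c ℓ) (i ℓ)

  o≡0 : ∀ ℓ → toℕ (o ℓ) ≡ 0
  o≡0 ℓ with i-corner ℓ
  ... | inj₁ i≡0 = i≡0
  ... | inj₂ i≡k = trans (Fin.opposite-prop (i ℓ)) (m≤n⇒m∸n≡0 (≤-reflexive (sym i≡k)))

blowup-bound : ∀ {e} {ks : Fin (suc e) → ℕ} (P : Matrix ks) → HasCornerOne P →
               ∀ r n → suc r ^ e * f n P ≤ e ! * f (suc r * n) P
blowup-bound {e} P hasCorner@(i , _ , Pi) r n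
  with c , o , o≡0 , Qo ← corner-reflection {P = P} hasCorner = begin
  suc r ^ e * f n P              ≤⟨ *-monoʳ-≤ (suc r ^ e) (f-reflect n c {P} {Q} {i} (Equivalence.from T-≡ Pi)
                                      (λ i → entry-cong P (λ ℓ → sym (flip-involutive (c ℓ) (i ℓ))))) ⟩
  suc r ^ e * f n Q              ≤⟨ blowup-bound-origin Q o≡0 Qo r n ⟩
  e ! * f (suc r * n) Q          ≤⟨ *-monoʳ-≤ (e !) (f-reflect (suc r * n) c {Q} {P} {o} Qo (λ _ → refl)) ⟩
  e ! * f (suc r * n) P          ∎
  where
  open ≤-Reasoning
  Q = reflect c P

-- Passage to rational numbers

-- Normalised fractions hide their numerators, so the comparison is made between unnormalised ones,
-- where it is a cross-multiplication of integers.
fraction-≤ : ∀ a b c q .{{_ : NonZero q}} → a * b ≤ q * c → (+ a / q) *ℚ (+ b / 1) ℚ.≤ + c / 1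
fraction-≤ a b c q@(suc q-1) ab≤qc = ℚ.toℚᵘ-cancel-≤ (begin
  ℚ.toℚᵘ ((+ a / q) *ℚ (+ b / 1))             ≃⟨ ℚ.toℚᵘ-homo-* (+ a / q) (+ b / 1) ⟩
  ℚ.toℚᵘ (+ a / q) ℚᵘ.* ℚ.toℚᵘ (+ b / 1)      ≃⟨ ℚᵘ.*-cong (ℚ.toℚᵘ-fromℚᵘ (ℚᵘ.mkℚᵘ (+ a) q-1))
                                                             (ℚ.toℚᵘ-fromℚᵘ (ℚᵘ.mkℚᵘ (+ b) 0)) ⟩
  ℚᵘ.mkℚᵘ (+ a) q-1 ℚᵘ.* ℚᵘ.mkℚᵘ (+ b) 0      ≤⟨ ℚᵘ.*≤* cross ⟩
  ℚᵘ.mkℚᵘ (+ c) 0                             ≃⟨ ℚ.toℚᵘ-fromℚᵘ (ℚᵘ.mkℚᵘ (+ c) 0) ⟨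
  ℚ.toℚᵘ (+ c / 1)                            ∎)
  where
  open ℚᵘ.≤-Reasoning
  cross : + a ℤ.* + b ℤ.* + 1 ℤ.≤ + c ℤ.* + (suc q-1 * 1)
  cross rewrite ℤ.*-identityʳ (+ a ℤ.* + b) | *-identityʳ q-1 | sym (ℤ.pos-* a b) | sym (ℤ.pos-* c q) =
    ℤ.+≤+ (subst (a * b ≤_) (*-comm q c) ab≤qc)

lemma4p7 : (d : ℕ) .{{_ : NonZero d}} (ks : Fin d → ℕ) (P : Matrix ks) → HasCornerOne P →
    (s n : ℕ) .{{_ : NonZero s}} .{{_ : NonZero n}} →
    (+ f (s * n) P / 1) ≥ (_/_ (+ (s ^ pred d)) (pred d !) {{pred d !≢0}} *ℚ (+ f n P / 1))
lemma4p7 (suc e) ks P hasCorner (suc r) n =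
  fraction-≤ (suc r ^ e) (f n P) (f (suc r * n) P) (e !) {{e !≢0}} (blowup-bound P hasCorner r n)
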